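{- Let $n\geq 1$ and let $B\subseteq[n-1]$. The number of permutations $\sigma\in\tilde{\mathfrak S}_{n+1}$ with $D_3(\sigma)=B$ equals the number of permutations $\omega\in\mathfrak S_n$ with $\hat D(\omega)=B$.
   Context: $\mathfrak S_n$ is the set of permutations $\sigma=\sigma_1\cdots\sigma_n$ of $[n]=\{1,\dots,n\}$ (in one-line notation), and $\tilde{\mathfrak S}_{n}$ is the set of $\sigma\in\mathfrak S_n$ with $\sigma_1=1$. A permutation $\sigma\in\mathfrak S_m$ has a $3$-descent at position $i\in[m-2]$ if the triple $\sigma_i\sigma_{i+1}\sigma_{i+2}$, viewed (after standardization) as an element of $\mathfrak S_3$, is an odd permutation; $D_3(\sigma)$ is the set of such positions. A permutation $\omega\in\mathfrak S_n$ has an alternating descent at $i\in[n-1]$ if either $i$ is odd and $\omega_i>\omega_{i+1}$, or $i$ is even and $\omega_i<\omega_{i+1}$; $\hat D(\omega)$ is the set of such positions. -}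

module Defs where

open import Data.Nat using (ℕ; zero; suc; _<ᵇ_)
open import Data.Bool using (Bool; true; false; _xor_; if_then_else_)
open import Data.Fin using (Fin; zero; suc; toℕ; inject₁)
open import Data.Fin.Subset using (Subset)
open import Data.Fin.Permutation using (Permutation′; _⟨$⟩ʳ_)
open import Data.Vec using (tabulate)
open import Data.Product using (Σ; proj₁)
open import Relation.Binary.PropositionalEquality using (_≡_; refl; sym; trans)
open import Relation.Binary.Bundles using (Setoid)
open import Level using (0ℓ)

-- Value of a permutation at a position, as a natural number
-- (0-indexed positions and values; shifting by 1 does not affect comparisons).
_·_ : ∀ {n} → Permutation′ n → Fin n → ℕ
π · i = toℕ (π ⟨$⟩ʳ i)

isEven : ℕ → Bool
isEven zero = true
isEven (suc k) = if isEven k then false else true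

-- A triple a b c of distinct values standardizes to an odd permutation of S_3
-- iff its number of inversions is odd.
oddTriple : ℕ → ℕ → ℕ → Bool
oddTriple a b c = (b <ᵇ a) xor ((c <ᵇ a) xor (c <ᵇ b))

-- For σ ∈ S_{m+2} and j : Fin m (representing position i = j+1 ∈ [m]),
-- whether σ has a 3-descent at position i: σ_i σ_{i+1} σ_{i+2} odd.
has3Desc : ∀ {m} → Permutation′ (suc (suc m)) → Fin m → Bool
has3Desc σ j = oddTriple (σ · inject₁ (inject₁ j)) (σ · inject₁ (suc j)) (σ · suc (suc j))

D3 : ∀ {m} → Permutation′ (suc (suc m)) → Subset m
D3 σ = tabulate (has3Desc σ)

-- For ω ∈ S_{m+1} and j : Fin m (position i = j+1 ∈ [m]): alternating descent at i.
-- i odd ⇔ j even: descent ω_i > ω_{i+1}; i even: ascent ω_i < ω_{i+1}.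
hasAltDesc : ∀ {m} → Permutation′ (suc m) → Fin m → Bool
hasAltDesc ω j =
  if isEven (toℕ j)
  then (ω · suc j) <ᵇ (ω · inject₁ j)
  else (ω · inject₁ j) <ᵇ (ω · suc j)

Dhat : ∀ {m} → Permutation′ (suc m) → Subset m
Dhat ω = tabulate (hasAltDesc ω)

-- The set { π ∈ S_n | P π } as a setoid, where permutations are identified
-- extensionally (pointwise equal as functions). A bijection (Inverse) between
-- two such finite setoids expresses that the sets have the same cardinality.
PermSet : (n : ℕ) → (Permutation′ n → Set) → Setoid 0ℓ 0ℓ
PermSet n P = record
  { Carrier = Σ (Permutation′ n) P
  ; _≈_ = λ x y → ∀ i → proj₁ x ⟨$⟩ʳ i ≡ proj₁ y ⟨$⟩ʳ i
  ; isEquivalence = record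
    { refl = λ i → refl
    ; sym = λ p i → sym (p i)
    ; trans = λ p q i → trans (p i) (q i)
    }
  }

-- { σ ∈ S̃_{m+2} | D_3(σ) = B }   (σ_1 = 1 is σ(0) = 0 in 0-indexing)
TildeD3Set : (m : ℕ) → Subset m → Setoid 0ℓ 0ℓ
TildeD3Set m B = PermSet (suc (suc m)) (λ σ → (σ ⟨$⟩ʳ zero ≡ zero) Data.Product.× (D3 σ ≡ B))

AltSet : (m : ℕ) → Subset m → Setoid 0ℓ 0ℓ
AltSet m B = PermSet (suc m) (λ ω → Dhat ω ≡ B)

-- Positions and values are 0-indexed, so σ ∈ S̃_{k+1} means σ(0) = 0.  We build
-- a bijection Φ : S̃_{k+1} → S_k one position at a time: deleting the last entry
-- of σ and standardising (remove) gives σ′ ∈ S̃_k, and Φσ is Φσ′ with an entry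
-- appended (insert) whose relative value is ρ_k(g), where g is the cyclic gap
-- mod k+1 from the last value of σ′ to the last value of σ minus one, and ρ_k is
-- the identity for even k and x ↦ k - x for odd k.  Cyclic addition undoes the
-- gap and ρ_k is an involution, giving the inverse Ψ.  Standardisation is an
-- order-preserving relabelling (punchIn), so all descents but the last are
-- inherited from σ′ and Φσ′; at the last position, both the parity of the final
-- triple of σ and the last alternating descent of Φσ amount to m < u₁ + u₂ for
-- the last two recorded gaps (oddTriple-by-gaps, altCompare-by-gaps).
module Submission where

open import Defs
open import Data.Nat using (ℕ; zero; suc; _+_; _∸_; _<ᵇ_; _≤_; _<_; s≤s; s≤s⁻¹; _<?_; _≤?_)
open import Data.Nat.Properties hiding (_≟_)
open import Data.Nat.Solver using (module +-*-Solver)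
open import Data.Bool using (Bool; true; false; not; if_then_else_; _xor_; T)
open import Data.Bool.Properties using (T-≡; xor-identityʳ; xor-comm)
open import Data.Fin using (Fin; zero; suc; toℕ; fromℕ; fromℕ<; inject₁; punchIn; opposite)
open import Data.Fin.Properties using (toℕ-fromℕ<; toℕ<n; toℕ-inject₁; toℕ-injective; toℕ-fromℕ; punchIn-injective; opposite-prop; opposite-involutive; _≟_)
open import Data.Fin.Subset using (Subset)
open import Data.Fin.Permutation as Perm using (Permutation′; _⟨$⟩ʳ_; _⟨$⟩ˡ_; _≈_; insert; remove; insert-punchIn; insert-remove; remove-insert; punchIn-permute; inverseˡ)
open import Data.Vec.Properties using (tabulate-cong)
open import Data.Product using (_,_; proj₁; proj₂)
open import Function using (_∘_)
open import Function.Bundles using (Inverse; Equivalence)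
open import Relation.Nullary using (yes; no; contradiction)
open import Relation.Binary.PropositionalEquality
open import Algebra.Properties.CommutativeSemigroup +-commutativeSemigroup using (xy∙z≈xz∙y)
open ≡-Reasoning

cong₃ : ∀ {A B C D : Set} (f : A → B → C → D) {a a′ b b′ c c′} →
        a ≡ a′ → b ≡ b′ → c ≡ c′ → f a b c ≡ f a′ b′ c′
cong₃ f refl refl refl = refl

<ᵇ-true : ∀ {x y} → x < y → (x <ᵇ y) ≡ true
<ᵇ-true x<y = Equivalence.to T-≡ (<⇒<ᵇ x<y)

<ᵇ-false : ∀ {x y} → y ≤ x → (x <ᵇ y) ≡ false
<ᵇ-false {x} {y} y≤x with x <ᵇ y in eq
... | false = refl
... | true  = contradiction (<ᵇ⇒< x y (subst T (sym eq) _)) (≤⇒≯ y≤x)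

<ᵇ-cong : ∀ {x y z w} → (x < y → z < w) → (z < w → x < y) → (x <ᵇ y) ≡ (z <ᵇ w)
<ᵇ-cong {x} {y} to from with x <? y
... | yes x<y = trans (<ᵇ-true x<y) (sym (<ᵇ-true (to x<y)))
... | no  x≮y = trans (<ᵇ-false (≮⇒≥ x≮y)) (sym (<ᵇ-false (≮⇒≥ (x≮y ∘ from))))

-- If s + a ≡ m + c then m < s exactly when a < c: the form in which both
-- last-position criteria are evaluated.
<ᵇ-balance : ∀ s a m c → s + a ≡ m + c → (m <ᵇ s) ≡ (a <ᵇ c)
<ᵇ-balance s a m c eq = <ᵇ-cong
  (λ m<s → +-cancelˡ-< m a c (subst (m + a <_) eq (+-monoˡ-< a m<s)))
  (λ a<c → +-cancelʳ-< a m s (subst (m + a <_) (sym eq) (+-monoʳ-< m a<c)))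

not-<ᵇ : ∀ x y → not (x <ᵇ y) ≡ (y <ᵇ suc x)
not-<ᵇ x y with x <? y
... | yes x<y = trans (cong not (<ᵇ-true x<y)) (sym (<ᵇ-false x<y))
... | no  x≮y = trans (cong not (<ᵇ-false (≮⇒≥ x≮y))) (sym (<ᵇ-true (s≤s (≮⇒≥ x≮y))))

-- The order-preserving injection ℕ → ℕ whose image misses p; it describes
-- how the values of a standardised prefix sit among the original values.
punchInℕ : ℕ → ℕ → ℕ
punchInℕ p y = if y <ᵇ p then y else suc y

punchInℕ-< : ∀ {p y} → y < p → punchInℕ p y ≡ y
punchInℕ-< {p} {y} y<p = cong (λ t → if t then y else suc y) (<ᵇ-true y<p)

punchInℕ-≥ : ∀ {p y} → p ≤ y → punchInℕ p y ≡ suc y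
punchInℕ-≥ {p} {y} p≤y = cong (λ t → if t then y else suc y) (<ᵇ-false p≤y)

punchInℕ-suc : ∀ p y → suc (punchInℕ p y) ≡ punchInℕ (suc p) (suc y)
punchInℕ-suc p y with y <ᵇ p
... | true  = refl
... | false = refl

toℕ-punchIn : ∀ {n} (p : Fin (suc n)) (y : Fin n) → toℕ (punchIn p y) ≡ punchInℕ (toℕ p) (toℕ y)
toℕ-punchIn zero    y       = refl
toℕ-punchIn (suc p) zero    = refl
toℕ-punchIn (suc p) (suc y) = trans (cong suc (toℕ-punchIn p y)) (punchInℕ-suc (toℕ p) (toℕ y))

punchInℕ-<ᵇ : ∀ p x y → (punchInℕ p x <ᵇ punchInℕ p y) ≡ (x <ᵇ y)
punchInℕ-<ᵇ p x y with x <? p | y <? p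
... | yes x<p | yes y<p rewrite punchInℕ-< x<p | punchInℕ-< y<p = refl
... | no  x≮p | no  y≮p rewrite punchInℕ-≥ (≮⇒≥ x≮p) | punchInℕ-≥ (≮⇒≥ y≮p) = refl
... | yes x<p | no  y≮p rewrite punchInℕ-< x<p | punchInℕ-≥ (≮⇒≥ y≮p) =
  trans (<ᵇ-true (m<n⇒m<1+n x<y)) (sym (<ᵇ-true x<y))
  where x<y = <-≤-trans x<p (≮⇒≥ y≮p)
... | no  x≮p | yes y<p rewrite punchInℕ-≥ (≮⇒≥ x≮p) | punchInℕ-< y<p =
  trans (<ᵇ-false (m≤n⇒m≤1+n y≤x)) (sym (<ᵇ-false y≤x))
  where y≤x = <⇒≤ (<-≤-trans y<p (≮⇒≥ x≮p))

punchInℕ-above : ∀ p x → (p <ᵇ punchInℕ p x) ≡ (p <ᵇ suc x)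
punchInℕ-above p x with x <? p
... | yes x<p rewrite punchInℕ-< x<p = trans (<ᵇ-false (<⇒≤ x<p)) (sym (<ᵇ-false x<p))
... | no  x≮p rewrite punchInℕ-≥ (≮⇒≥ x≮p) = refl

punchInℕ-below : ∀ p x → (punchInℕ p x <ᵇ p) ≡ (x <ᵇ p)
punchInℕ-below p x with x <? p
... | yes x<p rewrite punchInℕ-< x<p = refl
... | no  x≮p rewrite punchInℕ-≥ (≮⇒≥ x≮p) =
  trans (<ᵇ-false (m≤n⇒m≤1+n (≮⇒≥ x≮p))) (sym (<ᵇ-false (≮⇒≥ x≮p)))

gap : ℕ → ℕ → ℕ → ℕ
gap N b c = if c <ᵇ b then N + c ∸ b else c ∸ b

shift : ℕ → ℕ → ℕ → ℕ
shift N b u = if u + b <ᵇ N then u + b else u + b ∸ N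

gap-+-≤ : ∀ N {b c} → b ≤ c → gap N b c + b ≡ c
gap-+-≤ N {b} {c} b≤c =
  trans (cong (λ t → (if t then N + c ∸ b else c ∸ b) + b) (<ᵇ-false b≤c)) (m∸n+n≡m b≤c)

gap-+-> : ∀ N {b c} → c < b → b ≤ N → gap N b c + b ≡ N + c
gap-+-> N {b} {c} c<b b≤N =
  trans (cong (λ t → (if t then N + c ∸ b else c ∸ b) + b) (<ᵇ-true c<b))
        (m∸n+n≡m (≤-trans b≤N (m≤m+n N c)))

shift-< : ∀ N b u → u + b < N → shift N b u ≡ u + b
shift-< N b u lt = cong (λ t → if t then u + b else u + b ∸ N) (<ᵇ-true lt)

shift-≥ : ∀ N b u → N ≤ u + b → shift N b u ≡ u + b ∸ N
shift-≥ N b u ge = cong (λ t → if t then u + b else u + b ∸ N) (<ᵇ-false ge)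

gap<N : ∀ N {b c} → b ≤ N → c < N → gap N b c < N
gap<N N {b} {c} b≤N c<N with c <? b
... | yes c<b = +-cancelʳ-< b _ N (subst (_< N + b) (sym (gap-+-> N c<b b≤N)) (+-monoʳ-< N c<b))
... | no  c≮b = ≤-<-trans (m≤m+n _ b) (subst (_< N) (sym (gap-+-≤ N (≮⇒≥ c≮b))) c<N)

shift<N : ∀ N {b u} → b < N → u < N → shift N b u < N
shift<N N {b} {u} b<N u<N with u + b <? N
... | yes lt = subst (_< N) (sym (shift-< N b u lt)) lt
... | no  ≮ = subst (_< N) (sym (shift-≥ N b u (≮⇒≥ ≮)))
                (+-cancelʳ-< N _ N (subst (_< N + N) (sym (m∸n+n≡m (≮⇒≥ ≮))) (+-mono-< u<N b<N)))

shift-gap : ∀ N {b c} → b < N → c < N → shift N b (gap N b c) ≡ c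
shift-gap N {b} {c} b<N c<N with c <? b
... | no  c≮b = trans (shift-< N b _ (subst (_< N) (sym sum) c<N)) sum
  where sum = gap-+-≤ N (≮⇒≥ c≮b)
... | yes c<b = trans (shift-≥ N b _ (subst (N ≤_) (sym sum) (m≤m+n N c)))
                      (trans (cong (_∸ N) sum) (m+n∸m≡n N c))
  where sum = gap-+-> N c<b (<⇒≤ b<N)

gap-shift : ∀ N {b u} → b < N → u < N → gap N b (shift N b u) ≡ u
gap-shift N {b} {u} b<N u<N with u + b <? N
... | yes lt = begin
  gap N b (shift N b u)  ≡⟨ cong (gap N b) (shift-< N b u lt) ⟩
  gap N b (u + b)        ≡⟨ +-cancelʳ-≡ b _ u (gap-+-≤ N (m≤n+m b u)) ⟩
  u                      ∎
... | no  ≮ = +-cancelʳ-≡ b _ u (begin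
  gap N b (shift N b u) + b  ≡⟨ cong (λ s → gap N b s + b) (shift-≥ N b u (≮⇒≥ ≮)) ⟩
  gap N b (u + b ∸ N) + b    ≡⟨ gap-+-> N wrapped (<⇒≤ b<N) ⟩
  N + (u + b ∸ N)            ≡⟨ m+[n∸m]≡n (≮⇒≥ ≮) ⟩
  u + b                      ∎)
  where
  wrapped : u + b ∸ N < b
  wrapped = +-cancelʳ-< N _ b
    (subst (_< b + N) (sym (m∸n+n≡m (≮⇒≥ ≮))) (subst (u + b <_) (+-comm N b) (+-monoˡ-< b u<N)))

-- The sum of the cyclic gaps from a to b (mod m+1) and from b+1 to c
-- (mod m+2): the two gaps recorded by Φ at the last two positions.
gapSum : ℕ → ℕ → ℕ → ℕ → ℕ
gapSum m a b c = gap (suc m) a b + gap (suc (suc m)) (suc b) c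

-- The defining equations of the two gaps telescope: x and y are the
-- wrap-around amounts (0 or the modulus) added to b and c.
gapSum-telescope : ∀ m a b c x y → gap (suc m) a b + a ≡ x + b → gap (suc (suc m)) (suc b) c + suc b ≡ y →
                   suc (gapSum m a b c + a) ≡ x + y
gapSum-telescope m a b c x y e₁ e₂ = +-cancelʳ-≡ b _ _ (begin
  suc ((u₁ + u₂) + a) + b  ≡⟨ rearrange ⟩
  (u₁ + a) + (u₂ + suc b)  ≡⟨ cong₂ _+_ e₁ e₂ ⟩
  (x + b) + y              ≡⟨ xy∙z≈xz∙y x b y ⟩
  (x + y) + b              ∎)
  where
  open +-*-Solver
  u₁ = gap (suc m) a b
  u₂ = gap (suc (suc m)) (suc b) c
  rearrange : suc ((u₁ + u₂) + a) + b ≡ (u₁ + a) + (u₂ + suc b)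
  rearrange = solve 4 (λ u₁ u₂ a b → (con 1 :+ ((u₁ :+ u₂) :+ a)) :+ b := (u₁ :+ a) :+ (u₂ :+ (con 1 :+ b)))
                      refl u₁ u₂ a b

reflectℕ : Bool → ℕ → ℕ → ℕ
reflectℕ true  k x = x
reflectℕ false k x = k ∸ x

reflect : ∀ {n} → Bool → Fin n → Fin n
reflect true  x = x
reflect false x = opposite x

toℕ-reflect : ∀ e {k} (x : Fin (suc k)) → toℕ (reflect e x) ≡ reflectℕ e k (toℕ x)
toℕ-reflect true  x = refl
toℕ-reflect false x = opposite-prop x

reflect-involutive : ∀ e {n} (x : Fin n) → reflect e (reflect e x) ≡ x
reflect-involutive true  x = refl
reflect-involutive false x = opposite-involutive x

-- The parity of three inversion indicators; oddTriple a b c unfolds to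
-- parity (b <ᵇ a) (c <ᵇ a) (c <ᵇ b).
parity : Bool → Bool → Bool → Bool
parity x y z = x xor (y xor z)

oddTriple-punchIn : ∀ p a b c → oddTriple (punchInℕ p a) (punchInℕ p b) (punchInℕ p c) ≡ oddTriple a b c
oddTriple-punchIn p a b c = cong₃ parity (punchInℕ-<ᵇ p b a) (punchInℕ-<ᵇ p c a) (punchInℕ-<ᵇ p c b)

-- The parity of the last triple of σ ∈ S̃_{m+3} after evaluating the
-- comparisons with its last entry: the last value suc c was inserted last,
-- the middle value suc b just before it, and a is the value before that.
lastTripleParity : ℕ → ℕ → ℕ → Bool
lastTripleParity a b c = parity (b <ᵇ a) (c <ᵇ punchInℕ (suc b) a) (c <ᵇ suc b)

oddTriple-lastInserted : ∀ a b c →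
  oddTriple (punchInℕ (suc c) (punchInℕ (suc b) a)) (punchInℕ (suc c) (suc b)) (suc c) ≡ lastTripleParity a b c
oddTriple-lastInserted a b c = cong₃ parity
  (trans (punchInℕ-<ᵇ (suc c) (suc b) (punchInℕ (suc b) a)) (punchInℕ-above (suc b) a))
  (punchInℕ-above (suc c) (punchInℕ (suc b) a))
  (punchInℕ-above (suc c) (suc b))

-- The parity of the last triple in terms of the two cyclic gaps from a to b
-- (mod m+1) and from b+1 to c (mod m+2): one case per wrap-around pattern,
-- in each of which both sides evaluate to the same comparison.
oddTriple-by-gaps : ∀ m a b c → a ≤ m → b ≤ m → c ≤ suc m → (m <ᵇ gapSum m a b c) ≡ lastTripleParity a b c
oddTriple-by-gaps m a b c a≤m b≤m c≤m+1 with a ≤? b | b <? c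
... | yes a≤b | yes b<c = trans lhs (sym rhs)
  where
  sum = gapSum-telescope m a b c 0 c (gap-+-≤ (suc m) a≤b) (gap-+-≤ (suc (suc m)) b<c)
  lhs : (m <ᵇ gapSum m a b c) ≡ false
  lhs = <ᵇ-false (≤-trans (m≤m+n _ a) (s≤s⁻¹ (subst (_≤ suc m) (sym sum) c≤m+1)))
  rhs : lastTripleParity a b c ≡ false
  rhs = cong₃ parity (<ᵇ-false a≤b)
          (trans (cong (c <ᵇ_) (punchInℕ-< (s≤s a≤b))) (<ᵇ-false (≤-trans a≤b (<⇒≤ b<c))))
          (<ᵇ-false b<c)
... | no a≰b | yes b<c = trans lhs (sym rhs)
  where
  b<a = ≰⇒> a≰b
  sum = gapSum-telescope m a b c (suc m) c (gap-+-> (suc m) b<a (m≤n⇒m≤1+n a≤m)) (gap-+-≤ (suc (suc m)) b<c)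
  lhs : (m <ᵇ gapSum m a b c) ≡ (a <ᵇ c)
  lhs = <ᵇ-balance (gapSum m a b c) a m c (suc-injective sum)
  rhs : lastTripleParity a b c ≡ (a <ᵇ c)
  rhs = begin
    lastTripleParity a b c
      ≡⟨ cong₃ parity (<ᵇ-true b<a) (cong (c <ᵇ_) (punchInℕ-≥ b<a)) (<ᵇ-false b<c) ⟩
    not ((c <ᵇ suc a) xor false)  ≡⟨ cong not (xor-identityʳ _) ⟩
    not (c <ᵇ suc a)              ≡⟨ not-<ᵇ c (suc a) ⟩
    (a <ᵇ c)                      ∎
... | yes a≤b | no b≮c = trans lhs (sym rhs)
  where
  c≤b = ≮⇒≥ b≮c
  sum = gapSum-telescope m a b c 0 (suc (suc m) + c)
          (gap-+-≤ (suc m) a≤b) (gap-+-> (suc (suc m)) (s≤s c≤b) (s≤s (m≤n⇒m≤1+n b≤m)))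
  lhs : (m <ᵇ gapSum m a b c) ≡ (a <ᵇ suc c)
  lhs = <ᵇ-balance (gapSum m a b c) a m (suc c) (trans (suc-injective sum) (sym (+-suc m c)))
  rhs : lastTripleParity a b c ≡ (a <ᵇ suc c)
  rhs = begin
    lastTripleParity a b c
      ≡⟨ cong₃ parity (<ᵇ-false a≤b) (cong (c <ᵇ_) (punchInℕ-< (s≤s a≤b))) (<ᵇ-true (s≤s c≤b)) ⟩
    (c <ᵇ a) xor true  ≡⟨ xor-comm (c <ᵇ a) true ⟩
    not (c <ᵇ a)       ≡⟨ not-<ᵇ c a ⟩
    (a <ᵇ suc c)       ∎
... | no a≰b | no b≮c = trans lhs (sym rhs)
  where
  b<a = ≰⇒> a≰b
  c≤b = ≮⇒≥ b≮c
  sum = gapSum-telescope m a b c (suc m) (suc (suc m) + c)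
          (gap-+-> (suc m) b<a (m≤n⇒m≤1+n a≤m)) (gap-+-> (suc (suc m)) (s≤s c≤b) (s≤s (m≤n⇒m≤1+n b≤m)))
  lhs : (m <ᵇ gapSum m a b c) ≡ true
  lhs = trans (<ᵇ-balance (gapSum m a b c) a m (suc (suc m) + c) (suc-injective sum))
              (<ᵇ-true (s≤s (m≤n⇒m≤1+n (≤-trans a≤m (m≤m+n m c)))))
  rhs : lastTripleParity a b c ≡ true
  rhs = cong₃ parity (<ᵇ-true b<a)
          (trans (cong (c <ᵇ_) (punchInℕ-≥ b<a)) (<ᵇ-true (s≤s (≤-trans c≤b (<⇒≤ b<a)))))
          (<ᵇ-true (s≤s c≤b))

-- The comparison defining an alternating descent: a descent when e holds,
-- an ascent otherwise (hasAltDesc unfolds to it with e = isEven j).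
altCompare : Bool → ℕ → ℕ → Bool
altCompare e x y = if e then x <ᵇ y else y <ᵇ x

altCompare-punchIn : ∀ e p x y → altCompare e (punchInℕ p x) (punchInℕ p y) ≡ altCompare e x y
altCompare-punchIn true  p x y = punchInℕ-<ᵇ p x y
altCompare-punchIn false p x y = punchInℕ-<ᵇ p y x

-- The last alternating descent of Φσ in terms of the recorded gaps u₁, u₂:
-- the appended values are their reflections, of opposite parities.
altCompare-by-gaps : ∀ e m u₁ u₂ → u₁ ≤ m → u₂ ≤ suc m →
  altCompare e (reflectℕ (if e then false else true) (suc m) u₂)
               (punchInℕ (reflectℕ (if e then false else true) (suc m) u₂) (reflectℕ e m u₁))
  ≡ (m <ᵇ u₁ + u₂)
altCompare-by-gaps true m u₁ u₂ _ u₂≤m+1 =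
  trans (punchInℕ-above (suc m ∸ u₂) u₁) (sym (<ᵇ-balance (u₁ + u₂) (suc m ∸ u₂) m (suc u₁) sum))
  where
  sum : (u₁ + u₂) + (suc m ∸ u₂) ≡ m + suc u₁
  sum = begin
    (u₁ + u₂) + (suc m ∸ u₂)  ≡⟨ +-assoc u₁ u₂ _ ⟩
    u₁ + (u₂ + (suc m ∸ u₂))  ≡⟨ cong (u₁ +_) (m+[n∸m]≡n u₂≤m+1) ⟩
    u₁ + suc m                ≡⟨ +-comm u₁ (suc m) ⟩
    suc m + u₁                ≡⟨ +-suc m u₁ ⟨
    m + suc u₁                ∎
altCompare-by-gaps false m u₁ u₂ u₁≤m _ =
  trans (punchInℕ-below u₂ (m ∸ u₁)) (sym (<ᵇ-balance (u₁ + u₂) (m ∸ u₁) m u₂ sum))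
  where
  sum : (u₁ + u₂) + (m ∸ u₁) ≡ m + u₂
  sum = trans (xy∙z≈xz∙y u₁ u₂ (m ∸ u₁)) (cong (_+ u₂) (m+[n∸m]≡n u₁≤m))

gapF : ∀ {k} → Fin (suc k) → Fin (suc k) → Fin (suc k)
gapF {k} b c = fromℕ< (gap<N (suc k) (<⇒≤ (toℕ<n b)) (toℕ<n c))

shiftF : ∀ {k} → Fin (suc k) → Fin (suc k) → Fin (suc k)
shiftF {k} b u = fromℕ< (shift<N (suc k) (toℕ<n b) (toℕ<n u))

toℕ-gapF : ∀ {k} (b c : Fin (suc k)) → toℕ (gapF b c) ≡ gap (suc k) (toℕ b) (toℕ c)
toℕ-gapF b c = toℕ-fromℕ< _

shiftF-gapF : ∀ {k} (b c : Fin (suc k)) → shiftF b (gapF b c) ≡ c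
shiftF-gapF {k} b c = toℕ-injective (begin
  toℕ (shiftF b (gapF b c))                     ≡⟨ toℕ-fromℕ< _ ⟩
  shift (suc k) (toℕ b) (toℕ (gapF b c))        ≡⟨ cong (shift (suc k) (toℕ b)) (toℕ-gapF b c) ⟩
  shift (suc k) (toℕ b) (gap (suc k) (toℕ b) (toℕ c)) ≡⟨ shift-gap (suc k) (toℕ<n b) (toℕ<n c) ⟩
  toℕ c                                         ∎)

gapF-shiftF : ∀ {k} (b u : Fin (suc k)) → gapF b (shiftF b u) ≡ u
gapF-shiftF {k} b u = toℕ-injective (begin
  toℕ (gapF b (shiftF b u))                     ≡⟨ toℕ-gapF b (shiftF b u) ⟩
  gap (suc k) (toℕ b) (toℕ (shiftF b u))        ≡⟨ cong (gap (suc k) (toℕ b)) (toℕ-fromℕ< _) ⟩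
  gap (suc k) (toℕ b) (shift (suc k) (toℕ b) (toℕ u)) ≡⟨ gap-shift (suc k) (toℕ<n b) (toℕ<n u) ⟩
  toℕ u                                         ∎)

-- Predecessor, used on values known to be nonzero.
predF : ∀ {k} → Fin (suc (suc k)) → Fin (suc k)
predF zero    = zero
predF (suc x) = x

lastValue : ∀ k → Fin (suc k) → Fin (suc (suc k)) → Fin (suc k)
lastValue k t c = reflect (isEven k) (gapF t (predF c))

restoreValue : ∀ k → Fin (suc k) → Fin (suc k) → Fin (suc (suc k))
restoreValue k t d = suc (shiftF t (reflect (isEven k) d))

lastValue-restoreValue : ∀ k t d → lastValue k t (restoreValue k t d) ≡ d
lastValue-restoreValue k t d =
  trans (cong (reflect (isEven k)) (gapF-shiftF t _)) (reflect-involutive (isEven k) d)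

restoreValue-lastValue : ∀ k t c → restoreValue k t (lastValue k t (suc c)) ≡ suc c
restoreValue-lastValue k t c =
  cong suc (trans (cong (shiftF t) (reflect-involutive (isEven k) _)) (shiftF-gapF t c))

removeLast : ∀ {n} → Permutation′ (suc n) → Permutation′ n
removeLast {n} = remove (fromℕ n)

insertLast : ∀ {n} → Fin (suc n) → Permutation′ n → Permutation′ (suc n)
insertLast {n} = insert (fromℕ n)

insert-lookup : ∀ {n} (i j : Fin (suc n)) (π : Permutation′ n) → insert i j π ⟨$⟩ʳ i ≡ j
insert-lookup i j π with i ≟ i
... | yes _  = refl
... | no i≢i = contradiction refl i≢i

insert-cong : ∀ {n} (i : Fin (suc n)) {j j′ : Fin (suc n)} {π ρ : Permutation′ n} →
              j ≡ j′ → π ≈ ρ → insert i j π ≈ insert i j′ ρ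
insert-cong i refl π≈ρ k with i ≟ k
... | yes _ = refl
... | no  _ = cong (punchIn _) (π≈ρ _)

remove-cong : ∀ {n} (i : Fin (suc n)) {π ρ : Permutation′ (suc n)} → π ≈ ρ → remove i π ≈ remove i ρ
remove-cong i {π} {ρ} π≈ρ k = punchIn-injective (ρ ⟨$⟩ʳ i) _ _ (begin
  punchIn (ρ ⟨$⟩ʳ i) (remove i π ⟨$⟩ʳ k)  ≡⟨ cong (λ v → punchIn v _) (π≈ρ i) ⟨
  punchIn (π ⟨$⟩ʳ i) (remove i π ⟨$⟩ʳ k)  ≡⟨ punchIn-permute π i k ⟨
  π ⟨$⟩ʳ punchIn i k                      ≡⟨ π≈ρ (punchIn i k) ⟩
  ρ ⟨$⟩ʳ punchIn i k                      ≡⟨ punchIn-permute ρ i k ⟩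
  punchIn (ρ ⟨$⟩ʳ i) (remove i ρ ⟨$⟩ʳ k)  ∎)

punchIn-fromℕ : ∀ {n} (j : Fin n) → punchIn (fromℕ n) j ≡ inject₁ j
punchIn-fromℕ {suc n} zero    = refl
punchIn-fromℕ {suc n} (suc j) = cong suc (punchIn-fromℕ j)

removeLast-lookup : ∀ {n} (σ : Permutation′ (suc n)) (x : Fin n) →
                    σ ⟨$⟩ʳ inject₁ x ≡ punchIn (σ ⟨$⟩ʳ fromℕ n) (removeLast σ ⟨$⟩ʳ x)
removeLast-lookup σ x = trans (cong (σ ⟨$⟩ʳ_) (sym (punchIn-fromℕ x))) (punchIn-permute σ (fromℕ _) x)

insertLast-lookup : ∀ {n} (d : Fin (suc n)) (π : Permutation′ n) (x : Fin n) →
                    insertLast d π ⟨$⟩ʳ inject₁ x ≡ punchIn d (π ⟨$⟩ʳ x)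
insertLast-lookup d π x = trans (cong (insertLast d π ⟨$⟩ʳ_) (sym (punchIn-fromℕ x))) (insert-punchIn (fromℕ _) d π x)

removeLast-value : ∀ {n} (σ : Permutation′ (suc n)) (x : Fin n) →
                   σ · inject₁ x ≡ punchInℕ (σ · fromℕ n) (removeLast σ · x)
removeLast-value σ x = trans (cong toℕ (removeLast-lookup σ x)) (toℕ-punchIn _ _)

insertLast-value : ∀ {n} (d : Fin (suc n)) (π : Permutation′ n) (x : Fin n) →
                   insertLast d π · inject₁ x ≡ punchInℕ (toℕ d) (π · x)
insertLast-value d π x = trans (cong toℕ (insertLast-lookup d π x)) (toℕ-punchIn _ _)

removeLast-fixesZero : ∀ {k} (σ : Permutation′ (suc (suc k))) → σ ⟨$⟩ʳ zero ≡ zero → removeLast σ ⟨$⟩ʳ zero ≡ zero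
removeLast-fixesZero σ σ₀ = punchIn-zero _ _ (trans (sym (removeLast-lookup σ zero)) σ₀)
  where
  punchIn-zero : ∀ {n} (c : Fin (suc (suc n))) (y : Fin (suc n)) → punchIn c y ≡ zero → y ≡ zero
  punchIn-zero zero    y       ()
  punchIn-zero (suc c) zero    _  = refl
  punchIn-zero (suc c) (suc y) ()

lookup-suc : ∀ {k} (σ : Permutation′ (suc (suc k))) → σ ⟨$⟩ʳ zero ≡ zero →
             ∀ i → σ ⟨$⟩ʳ suc i ≡ suc (predF (σ ⟨$⟩ʳ suc i))
lookup-suc σ σ₀ i with σ ⟨$⟩ʳ suc i in eq
... | suc _ = refl
... | zero  = contradiction (begin
  suc i                   ≡⟨ inverseˡ σ ⟨
  σ ⟨$⟩ˡ (σ ⟨$⟩ʳ suc i)  ≡⟨ cong (σ ⟨$⟩ˡ_) (trans eq (sym σ₀)) ⟩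
  σ ⟨$⟩ˡ (σ ⟨$⟩ʳ zero)   ≡⟨ inverseˡ σ ⟩
  zero                    ∎) λ ()

Φ-value : ∀ k → Permutation′ (suc (suc k)) → Fin (suc k)
Φ-value k σ = lastValue k (removeLast σ ⟨$⟩ʳ fromℕ k) (σ ⟨$⟩ʳ fromℕ (suc k))

Φ : ∀ k → Permutation′ (suc k) → Permutation′ k
Φ zero    σ = Perm.id
Φ (suc k) σ = insertLast (Φ-value k σ) (Φ k (removeLast σ))

appendRestored : ∀ {k} → Permutation′ (suc k) → Fin (suc k) → Permutation′ (suc (suc k))
appendRestored {k} τ d = insertLast (restoreValue k (τ ⟨$⟩ʳ fromℕ k) d) τ

Ψ : ∀ k → Permutation′ k → Permutation′ (suc k)
Ψ zero    ω = Perm.id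
Ψ (suc k) ω = appendRestored (Ψ k (removeLast ω)) (ω ⟨$⟩ʳ fromℕ k)

removeLast-appendRestored : ∀ {k} (τ : Permutation′ (suc k)) d → removeLast (appendRestored τ d) ≈ τ
removeLast-appendRestored {k} τ d = remove-insert (fromℕ (suc k)) (restoreValue k (τ ⟨$⟩ʳ fromℕ k) d) τ

Φ-value-appendRestored : ∀ {k} (τ : Permutation′ (suc k)) d → Φ-value k (appendRestored τ d) ≡ d
Φ-value-appendRestored {k} τ d = trans
  (cong₂ (lastValue k) (removeLast-appendRestored τ d (fromℕ k)) (insert-lookup (fromℕ (suc k)) _ τ))
  (lastValue-restoreValue k (τ ⟨$⟩ʳ fromℕ k) d)

restoreValue-Φ-value : ∀ k (σ : Permutation′ (suc (suc k))) → σ ⟨$⟩ʳ zero ≡ zero →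
                       restoreValue k (removeLast σ ⟨$⟩ʳ fromℕ k) (Φ-value k σ) ≡ σ ⟨$⟩ʳ fromℕ (suc k)
restoreValue-Φ-value k σ σ₀ = begin
  restoreValue k t (lastValue k t (σ ⟨$⟩ʳ fromℕ (suc k)))  ≡⟨ cong (restoreValue k t ∘ lastValue k t) last≡ ⟩
  restoreValue k t (lastValue k t (suc c))                  ≡⟨ restoreValue-lastValue k t c ⟩
  suc c                                                     ≡⟨ last≡ ⟨
  σ ⟨$⟩ʳ fromℕ (suc k)                                      ∎
  where
  t = removeLast σ ⟨$⟩ʳ fromℕ k
  c = predF (σ ⟨$⟩ʳ fromℕ (suc k))
  last≡ = lookup-suc σ σ₀ (fromℕ k)

Φ-cong : ∀ k {σ τ} → σ ≈ τ → Φ k σ ≈ Φ k τ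
Φ-cong zero    σ≈τ ()
Φ-cong (suc k) {σ} {τ} σ≈τ =
  insert-cong (fromℕ k) {π = Φ k (removeLast σ)} {ρ = Φ k (removeLast τ)}
    (cong₂ (lastValue k) (removed (fromℕ k)) (σ≈τ (fromℕ (suc k))))
    (Φ-cong k {removeLast σ} {removeLast τ} removed)
  where
  removed : removeLast σ ≈ removeLast τ
  removed = remove-cong (fromℕ (suc k)) {σ} {τ} σ≈τ

Ψ-cong : ∀ k {ω ν} → ω ≈ ν → Ψ k ω ≈ Ψ k ν
Ψ-cong zero    ω≈ν i = refl
Ψ-cong (suc k) {ω} {ν} ω≈ν =
  insert-cong (fromℕ (suc k)) {π = Ψ k (removeLast ω)} {ρ = Ψ k (removeLast ν)}
    (cong₂ (restoreValue k) (prefix (fromℕ k)) (ω≈ν (fromℕ k))) prefix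
  where
  prefix : Ψ k (removeLast ω) ≈ Ψ k (removeLast ν)
  prefix = Ψ-cong k {removeLast ω} {removeLast ν} (remove-cong (fromℕ k) {ω} {ν} ω≈ν)

Ψ-fixesZero : ∀ k ω → Ψ k ω ⟨$⟩ʳ zero ≡ zero
Ψ-fixesZero zero    ω = refl
Ψ-fixesZero (suc k) ω = trans (insertLast-lookup _ τ zero) (cong (punchIn _) (Ψ-fixesZero k (removeLast ω)))
  where τ = Ψ k (removeLast ω)

ΦΨ : ∀ k ω → Φ k (Ψ k ω) ≈ ω
ΦΨ zero    ω ()
ΦΨ (suc k) ω i = trans
  (insert-cong (fromℕ k) {π = Φ k (removeLast σ)} {ρ = removeLast ω} (Φ-value-appendRestored τ d) prefix i)
  (insert-remove (fromℕ k) ω i)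
  where
  τ = Ψ k (removeLast ω)
  d = ω ⟨$⟩ʳ fromℕ k
  σ = appendRestored τ d
  prefix : Φ k (removeLast σ) ≈ removeLast ω
  prefix j = trans (Φ-cong k {removeLast σ} {τ} (removeLast-appendRestored τ d) j) (ΦΨ k (removeLast ω) j)

ΨΦ : ∀ k σ → σ ⟨$⟩ʳ zero ≡ zero → Ψ k (Φ k σ) ≈ σ
ΨΦ zero    σ σ₀ zero = sym σ₀
ΨΦ (suc k) σ σ₀ i = trans
  (insert-cong (fromℕ (suc k)) {π = Ψ k (removeLast ω)} {ρ = removeLast σ} value prefix i)
  (insert-remove (fromℕ (suc k)) σ i)
  where
  ω = Φ (suc k) σ
  prefix : Ψ k (removeLast ω) ≈ removeLast σ
  prefix j = trans
    (Ψ-cong k {removeLast ω} {Φ k (removeLast σ)} (remove-insert (fromℕ k) (Φ-value k σ) (Φ k (removeLast σ))) j)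
    (ΨΦ k (removeLast σ) (removeLast-fixesZero σ σ₀) j)
  value : restoreValue k (Ψ k (removeLast ω) ⟨$⟩ʳ fromℕ k) (ω ⟨$⟩ʳ fromℕ k) ≡ σ ⟨$⟩ʳ fromℕ (suc k)
  value = trans (cong₂ (restoreValue k) (prefix (fromℕ k)) (insert-lookup (fromℕ k) (Φ-value k σ) _))
                (restoreValue-Φ-value k σ σ₀)

has3Desc-removeLast : ∀ {m} (σ : Permutation′ (suc (suc (suc m)))) (j : Fin m) →
                      has3Desc σ (inject₁ j) ≡ has3Desc (removeLast σ) j
has3Desc-removeLast σ j =
  trans (cong₃ oddTriple (removeLast-value σ _) (removeLast-value σ _) (removeLast-value σ _))
        (oddTriple-punchIn (σ · fromℕ _) (σ′ · inject₁ (inject₁ j)) (σ′ · inject₁ (suc j)) (σ′ · suc (suc j)))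
  where σ′ = removeLast σ

hasAltDesc-insertLast : ∀ {m} (d : Fin (suc (suc m))) (ω : Permutation′ (suc m)) (j : Fin m) →
                        hasAltDesc (insertLast d ω) (inject₁ j) ≡ hasAltDesc ω j
hasAltDesc-insertLast d ω j =
  trans (cong₃ altCompare (cong isEven (toℕ-inject₁ j)) (insertLast-value d ω (suc j)) (insertLast-value d ω (inject₁ j)))
        (altCompare-punchIn (isEven (toℕ j)) (toℕ d) (ω · suc j) (ω · inject₁ j))

lastGap : ∀ {k} → Permutation′ (suc (suc k)) → ℕ
lastGap {k} σ = toℕ (gapF (removeLast σ ⟨$⟩ʳ fromℕ k) (predF (σ ⟨$⟩ʳ fromℕ (suc k))))

has3Desc-last : ∀ m (σ : Permutation′ (suc (suc (suc m)))) → σ ⟨$⟩ʳ zero ≡ zero →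
                has3Desc σ (fromℕ m) ≡ (m <ᵇ lastGap (removeLast σ) + lastGap σ)
has3Desc-last m σ σ₀ = begin
  has3Desc σ (fromℕ m)
    ≡⟨ cong₃ oddTriple value₁ value₂ C≡ ⟩
  oddTriple (punchInℕ (suc c) (punchInℕ (suc b) a)) (punchInℕ (suc c) (suc b)) (suc c)
    ≡⟨ oddTriple-lastInserted a b c ⟩
  lastTripleParity a b c
    ≡⟨ oddTriple-by-gaps m a b c (s≤s⁻¹ (toℕ<n A)) (s≤s⁻¹ (toℕ<n (predF B))) (s≤s⁻¹ (toℕ<n (predF C))) ⟨
  (m <ᵇ gapSum m a b c)
    ≡⟨ cong₂ (λ u₁ u₂ → m <ᵇ u₁ + u₂) (toℕ-gapF A (predF B))
             (trans (toℕ-gapF B (predF C)) (cong (λ t → gap (suc (suc m)) t c) B≡)) ⟨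
  (m <ᵇ lastGap σ′ + lastGap σ) ∎
  where
  σ′ = removeLast σ
  A = removeLast σ′ ⟨$⟩ʳ fromℕ m
  B = σ′ ⟨$⟩ʳ fromℕ (suc m)
  C = σ ⟨$⟩ʳ fromℕ (suc (suc m))
  a = toℕ A
  b = toℕ (predF B)
  c = toℕ (predF C)
  C≡ : toℕ C ≡ suc c
  C≡ = cong toℕ (lookup-suc σ σ₀ (fromℕ (suc m)))
  B≡ : toℕ B ≡ suc b
  B≡ = cong toℕ (lookup-suc σ′ (removeLast-fixesZero σ σ₀) (fromℕ m))
  value₂ : σ · inject₁ (fromℕ (suc m)) ≡ punchInℕ (suc c) (suc b)
  value₂ = trans (removeLast-value σ _) (cong₂ punchInℕ C≡ B≡)
  value₁ : σ · inject₁ (inject₁ (fromℕ m)) ≡ punchInℕ (suc c) (punchInℕ (suc b) a)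
  value₁ = trans (removeLast-value σ _) (cong₂ punchInℕ C≡ (trans (removeLast-value σ′ _) (cong₂ punchInℕ B≡ refl)))

hasAltDesc-last : ∀ m (σ : Permutation′ (suc (suc (suc m)))) →
                  hasAltDesc (Φ (suc (suc m)) σ) (fromℕ m) ≡ (m <ᵇ lastGap (removeLast σ) + lastGap σ)
hasAltDesc-last m σ =
  trans (cong₃ altCompare (cong isEven (toℕ-fromℕ m)) value₂ value₁)
        (altCompare-by-gaps (isEven m) m (lastGap σ′) (lastGap σ) (s≤s⁻¹ (toℕ<n _)) (s≤s⁻¹ (toℕ<n _)))
  where
  σ′ = removeLast σ
  d = lastValue (suc m) (σ′ ⟨$⟩ʳ fromℕ (suc m)) (σ ⟨$⟩ʳ fromℕ (suc (suc m)))
  d′ = lastValue m (removeLast σ′ ⟨$⟩ʳ fromℕ m) (σ′ ⟨$⟩ʳ fromℕ (suc m))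
  ω = Φ (suc (suc m)) σ
  d-value : toℕ d ≡ reflectℕ (isEven (suc m)) (suc m) (lastGap σ)
  d-value = toℕ-reflect (isEven (suc m)) _
  value₂ : ω · fromℕ (suc m) ≡ reflectℕ (isEven (suc m)) (suc m) (lastGap σ)
  value₂ = trans (cong toℕ (insert-lookup (fromℕ (suc m)) d _)) d-value
  value₁ : ω · inject₁ (fromℕ m)
           ≡ punchInℕ (reflectℕ (isEven (suc m)) (suc m) (lastGap σ)) (reflectℕ (isEven m) m (lastGap σ′))
  value₁ = trans (insertLast-value d _ (fromℕ m))
                 (cong₂ punchInℕ d-value (trans (cong toℕ (insert-lookup (fromℕ m) d′ _)) (toℕ-reflect (isEven m) _)))

data LastOrInner : ∀ {m} → Fin (suc m) → Set where
  last  : ∀ {m} → LastOrInner (fromℕ m)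
  inner : ∀ {m} (j : Fin m) → LastOrInner (inject₁ j)

lastOrInner : ∀ {m} (j : Fin (suc m)) → LastOrInner j
lastOrInner {zero}  zero    = last
lastOrInner {suc m} zero    = inner zero
lastOrInner {suc m} (suc j) with lastOrInner j
... | last    = last
... | inner i = inner (suc i)

descents-agree : ∀ m (σ : Permutation′ (suc (suc m))) → σ ⟨$⟩ʳ zero ≡ zero →
                 ∀ j → has3Desc σ j ≡ hasAltDesc (Φ (suc m) σ) j
descents-agree zero    σ σ₀ ()
descents-agree (suc m) σ σ₀ j = agree-at j (lastOrInner j)
  where
  -- Matching on the view (rather than with-abstracting it) keeps Φ folded.
  agree-at : ∀ j → LastOrInner j → has3Desc σ j ≡ hasAltDesc (Φ (suc (suc m)) σ) j
  agree-at _ last      = trans (has3Desc-last m σ σ₀) (sym (hasAltDesc-last m σ))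
  agree-at _ (inner i) = begin
    has3Desc σ (inject₁ i)                      ≡⟨ has3Desc-removeLast σ i ⟩
    has3Desc (removeLast σ) i                   ≡⟨ descents-agree m (removeLast σ) (removeLast-fixesZero σ σ₀) i ⟩
    hasAltDesc (Φ (suc m) (removeLast σ)) i     ≡⟨ hasAltDesc-insertLast (Φ-value (suc m) σ) _ i ⟨
    hasAltDesc (Φ (suc (suc m)) σ) (inject₁ i)  ∎

D3≡Dhat∘Φ : ∀ m (σ : Permutation′ (suc (suc m))) → σ ⟨$⟩ʳ zero ≡ zero → D3 σ ≡ Dhat (Φ (suc m) σ)
D3≡Dhat∘Φ m σ σ₀ = tabulate-cong (descents-agree m σ σ₀)

Dhat-cong : ∀ {m} {ω ν : Permutation′ (suc m)} → ω ≈ ν → Dhat ω ≡ Dhat ν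
Dhat-cong ω≈ν = tabulate-cong λ j →
  cong₂ (λ x y → altCompare (isEven (toℕ j)) (toℕ x) (toℕ y)) (ω≈ν (suc j)) (ω≈ν (inject₁ j))

D3∘Ψ≡Dhat : ∀ m (ω : Permutation′ (suc m)) → D3 (Ψ (suc m) ω) ≡ Dhat ω
D3∘Ψ≡Dhat m ω = trans (D3≡Dhat∘Φ m (Ψ (suc m) ω) (Ψ-fixesZero (suc m) ω))
                      (Dhat-cong {ω = Φ (suc m) (Ψ (suc m) ω)} {ν = ω} (ΦΨ (suc m) ω))

theorem2p3 : (m : ℕ) (B : Subset m) → Inverse (TildeD3Set m B) (AltSet m B)
theorem2p3 m B = record
  { to        = λ (σ , σ₀ , D₃σ≡B) → Φ (suc m) σ , trans (sym (D3≡Dhat∘Φ m σ σ₀)) D₃σ≡B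
  ; from      = λ (ω , D̂ω≡B) → Ψ (suc m) ω , Ψ-fixesZero (suc m) ω , trans (D3∘Ψ≡Dhat m ω) D̂ω≡B
  ; to-cong   = λ {σ} {τ} → Φ-cong (suc m) {proj₁ σ} {proj₁ τ}
  ; from-cong = λ {ω} {ν} → Ψ-cong (suc m) {proj₁ ω} {proj₁ ν}
  ; inverse   = (λ {ω} {σ} σ≈Ψω i → trans (Φ-cong (suc m) {proj₁ σ} {Ψ (suc m) (proj₁ ω)} σ≈Ψω i)
                                          (ΦΨ (suc m) (proj₁ ω) i))
              , (λ {σ} {ω} ω≈Φσ i → trans (Ψ-cong (suc m) {proj₁ ω} {Φ (suc m) (proj₁ σ)} ω≈Φσ i)
                                          (ΨΦ (suc m) (proj₁ σ) (proj₁ (proj₂ σ)) i))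
  }
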